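{- We have $c''_5=c''_{\le 5}\ge 5/7$.
   Context: All digraphs are finite. An oriented multigraph is a directed multigraph (parallel arcs allowed) without loops and without directed cycles of length 2; arcs are counted with multiplicity. For an oriented multigraph $D$, $n$ denotes its number of vertices. The degree of a vertex is the number of arcs incident with it (the sum of its out-degree and in-degree, counted with multiplicity), $\Delta(D)$ is the maximum degree, and $D$ is degree-$k$ if every vertex has degree exactly $k$. $\mathrm{fas}(D)$ is the minimum number of arcs in a feedback arc set of $D$, i.e. in a set $F$ of arcs such that $D-F$ has no directed cycle. Let $c''_{\le k}$ be the infimum of all reals $c$ such that $\mathrm{fas}(D)\le c\cdot n$ holds for all oriented multigraphs $D$ with $\Delta(D)\le k$. Let $c''_k$ be the infimum of all reals $c$ such that $\mathrm{fas}(D)\le c\cdot n$ holds for all degree-$k$ oriented multigraphs $D$. -}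

module Defs where

open import Level using (Level; 0ℓ; _⊔_) renaming (suc to lsuc)
open import Data.Fin.Base using (Fin; zero; suc; toℕ; fromℕ<)
open import Data.Fin.Properties as Fin using (any?; all?; injective⇒≤)
open import Data.Fin.Subset using (Subset; _∉_; ∣_∣) renaming (⊤ to full)
open import Data.Fin.Subset.Properties using (_∈?_; anySubset?; ∣p∣≤n; ∣⊤∣≡n; ∈⊤)
open import Data.Integer.Base as ℤ using (+_)
import Data.Integer.Properties as ℤ
open import Data.List.Base using (List; []; _∷_; length; filter; map; allFin)
open import Data.List.Extrema.Nat using (max; xs≤max; max≤v⁺)
open import Data.List.Membership.Propositional using () renaming (_∈_ to _∈ˡ_)
open import Data.List.Membership.Propositional.Properties using (∈-allFin; ∈-map⁺)
open import Data.List.Properties using (filter-all; filter-none; length-tabulate)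
open import Data.List.Relation.Unary.All as All using (All; []; _∷_)
import Data.List.Relation.Unary.All.Properties as All
open import Data.List.Relation.Unary.Any using (here; there)
open import Data.Nat.Base as ℕ using (ℕ; zero; suc; z≤n; s≤s)
open import Data.Nat.DivMod using (_mod_)
import Data.Nat.Properties as ℕ
open import Data.Product.Base using (Σ; ∃; _×_; _,_; proj₁; proj₂)
open import Data.Rational.Base as ℚ using (ℚ; 0ℚ; 1ℚ; _/_)
import Data.Rational.Properties as ℚ
import Data.Rational.Unnormalised.Base as ℚᵘ
import Data.Rational.Unnormalised.Properties as ℚᵘ
open import Function.Base using (_∘_; id)
open import Function.Definitions using (Injective)
open import Relation.Binary.PropositionalEquality
  using (_≡_; _≢_; refl; sym; trans; cong; cong₂; subst)
open import Relation.Nullary using (¬_; Dec; yes; no; ¬?; contradiction)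
open import Relation.Nullary.Decidable using (map′; _×-dec_; _→-dec_)
open import Relation.Unary using (Decidable)

private variable
  a b ℓ ℓ₁ ℓ₂ : Level

-- A real number x is given by its upper Dedekind cut, the set of the
-- rationals q with x < q.  Classically the upper cut determines the real
-- number, and every such cut comes from one.  No located lower cut is
-- required, so that infima of inhabited bounded sets exist constructively.
-- The level is that of the propositions "x < q"; it only records that an
-- infimum over real numbers quantifies over real numbers.

record ℝ (ℓ : Level) : Set (lsuc ℓ) where
  field
    Above     : ℚ → Set ℓ
    inhabited : ∃ Above
    bounded   : ∃ λ p → ∀ {q} → Above q → p ℚ.< q
    upward    : ∀ {p q} → p ℚ.< q → Above p → Above q
    rounded   : ∀ {q} → Above q → ∃ λ p → p ℚ.< q × Above p

open ℝ public

infix 4 _≤_ _≥_ _≃_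

_≤_ : ℝ ℓ₁ → ℝ ℓ₂ → Set (ℓ₁ ⊔ ℓ₂)
x ≤ y = ∀ {q} → Above y q → Above x q

_≥_ : ℝ ℓ₁ → ℝ ℓ₂ → Set (ℓ₁ ⊔ ℓ₂)
x ≥ y = y ≤ x

_≃_ : ℝ ℓ₁ → ℝ ℓ₂ → Set (ℓ₁ ⊔ ℓ₂)
x ≃ y = x ≤ y × y ≤ x

private
  p<p+1 : ∀ p → p ℚ.< p ℚ.+ 1ℚ
  p<p+1 p = subst (ℚ._< p ℚ.+ 1ℚ) (ℚ.+-identityʳ p)
              (ℚ.+-monoʳ-< p (ℚ.positive⁻¹ 1ℚ))

  p-1<p : ∀ p → p ℚ.- 1ℚ ℚ.< p
  p-1<p p = subst (p ℚ.- 1ℚ ℚ.<_) (ℚ.+-identityʳ p)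
              (ℚ.+-monoʳ-< p (ℚ.negative⁻¹ (ℚ.- 1ℚ)))

fromℚ : ℚ → ℝ 0ℓ
fromℚ p = record
  { Above     = p ℚ.<_
  ; inhabited = p ℚ.+ 1ℚ , p<p+1 p
  ; bounded   = p , id
  ; upward    = λ q<r p<q → ℚ.<-trans p<q q<r
  ; rounded   = λ p<q → let r , p<r , r<q = ℚ.<-dense p<q in r , r<q , p<r
  }

toℚ : ℕ → ℚ
toℚ n = + n / 1

fromℕ : ℕ → ℝ 0ℓ
fromℕ n = fromℚ (toℚ n)

private
  toℚ-nonNeg : ∀ n → ℚ.NonNegative (toℚ n)
  toℚ-nonNeg n = ℚ.normalize-nonNeg n 1

  *toℚ-mono-≤ : ∀ n {p q} → p ℚ.≤ q → p ℚ.* toℚ n ℚ.≤ q ℚ.* toℚ n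
  *toℚ-mono-≤ n = ℚ.*-monoʳ-≤-nonNeg (toℚ n) {{toℚ-nonNeg n}}

infixl 7 _·_

-- With q = r * n in place of r * n < q, x · 0 would not be 0.

_·_ : ℝ ℓ → ℕ → ℝ ℓ
x · n = record
  { Above     = λ q → ∃ λ r → Above x r × r ℚ.* toℚ n ℚ.< q
  ; inhabited = let r , x<r = inhabited x in
                r ℚ.* toℚ n ℚ.+ 1ℚ , r , x<r , p<p+1 _
  ; bounded   = let p , p<x = bounded x in
                p ℚ.* toℚ n , λ (r , x<r , rn<q) →
                  ℚ.≤-<-trans (*toℚ-mono-≤ n (ℚ.<⇒≤ (p<x x<r))) rn<q
  ; upward    = λ p<q (r , x<r , rn<p) → r , x<r , ℚ.<-trans rn<p p<q
  ; rounded   = λ (r , x<r , rn<q) →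
                let s , rn<s , s<q = ℚ.<-dense rn<q in
                s , s<q , r , x<r , rn<s
  }

module _ (S : ℝ a → Set b) (S-inhabited : ∃ S)
         (S-bounded : ∃ λ p → ∀ x → S x → fromℚ p ≤ x) where

  inf : ℝ (lsuc a ⊔ b)
  inf = record
    { Above     = λ q → ∃ λ x → S x × Above x q
    ; inhabited = let x , x∈S = S-inhabited
                      q , x<q = inhabited x
                  in q , x , x∈S , x<q
    ; bounded   = let p , p≤S = S-bounded in
                  p , λ (x , x∈S , x<q) → p≤S x x∈S x<q
    ; upward    = λ p<q (x , x∈S , x<p) → x , x∈S , upward x p<q x<p
    ; rounded   = λ (x , x∈S , x<q) →
                  let p , p<q , x<p = rounded x x<q in
                  p , p<q , x , x∈S , x<p
    }

  inf-lower : ∀ x → S x → inf ≤ x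
  inf-lower x x∈S x<q = x , x∈S , x<q

  inf-greatest : (y : ℝ ℓ) → (∀ x → S x → y ≤ x) → y ≤ inf
  inf-greatest y y≤S (x , x∈S , x<q) = y≤S x x∈S x<q

record OrientedMultigraph : Set where
  field
    n m        : ℕ                -- numbers of vertices and arcs
    tail head  : Fin m → Fin n
    loopless   : ∀ e → tail e ≢ head e
    no-2-cycle : ∀ e f → ¬ (head e ≡ tail f × head f ≡ tail e)

module _ (D : OrientedMultigraph) where
  open OrientedMultigraph D

  outdegree indegree degree : Fin n → ℕ
  outdegree v = length (filter (λ e → tail e Fin.≟ v) (allFin m))
  indegree  v = length (filter (λ e → head e Fin.≟ v) (allFin m))
  degree    v = outdegree v ℕ.+ indegree v

  Δ : ℕ
  Δ = max 0 (map degree (allFin n))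

Δ≤ : ℕ → OrientedMultigraph → Set
Δ≤ k D = Δ D ℕ.≤ k

Degree : ℕ → OrientedMultigraph → Set
Degree k D = ∀ v → degree D v ≡ k

next : ∀ {k} → Fin (suc k) → Fin (suc k)
next {k} i = suc (toℕ i) mod suc k

module _ (D : OrientedMultigraph) where
  open OrientedMultigraph D

  -- The arcs arc 0, …, arc k form a directed cycle through the k + 1
  -- distinct vertices tail (arc 0), …, tail (arc k).

  IsCycle : ∀ {k} → (Fin (suc k) → Fin m) → Set
  IsCycle arc = Injective _≡_ _≡_ (tail ∘ arc)
              × (∀ i → head (arc i) ≡ tail (arc (next i)))

  CycleAvoiding : Subset m → Set
  CycleAvoiding F = ∃ λ k → Σ (Fin (suc k) → Fin m) λ arc →
                    IsCycle arc × (∀ i → arc i ∉ F)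

  IsFeedbackArcSet : Subset m → Set
  IsFeedbackArcSet F = ¬ CycleAvoiding F

  IsMinimumFAS : Subset m → Set
  IsMinimumFAS F = IsFeedbackArcSet F
                 × (∀ F′ → IsFeedbackArcSet F′ → ∣ F ∣ ℕ.≤ ∣ F′ ∣)

private
  _◂_ : ∀ {k} {A : Set} → A → (Fin k → A) → Fin (suc k) → A
  (x ◂ f) zero    = x
  (x ◂ f) (suc i) = f i

  anyFunction? : ∀ k {m} {P : (Fin k → Fin m) → Set ℓ} →
                 (∀ {f g} → (∀ i → f i ≡ g i) → P f → P g) →
                 Decidable P → Dec (∃ P)
  anyFunction? zero ext P? =
    map′ (_ ,_) (λ (f , Pf) → ext (λ ()) Pf) (P? λ ())
  anyFunction? (suc k) ext P? =
    map′ (λ (x , f , p) → x ◂ f , p)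
         (λ (f , p) → f zero , f ∘ suc , ext (λ { zero → refl ; (suc i) → refl }) p)
         (any? λ x → anyFunction? k
           (λ f≗g → ext λ { zero → refl ; (suc i) → f≗g i })
           (λ f → P? (x ◂ f)))

module _ (D : OrientedMultigraph) where
  open OrientedMultigraph D

  isCycle? : ∀ {k} (arc : Fin (suc k) → Fin m) → Dec (IsCycle D arc)
  isCycle? arc =
    map′ (λ h {i} {j} → h i j) (λ h i j → h {i} {j})
         (all? λ i → all? λ j →
           tail (arc i) Fin.≟ tail (arc j) →-dec i Fin.≟ j)
    ×-dec all? λ i → head (arc i) Fin.≟ tail (arc (next i))

  cycleAvoiding? : Decidable (CycleAvoiding D)
  cycleAvoiding? F =
    map′ (λ (k , c) → toℕ k , c)
         (λ (k , c@(arc , (inj , _) , _)) →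
           let k<n = injective⇒≤ inj in
           fromℕ< k<n , subst Avoiding (sym (Fin.toℕ-fromℕ< k<n)) c)
         (any? {n} λ k → anyFunction? (suc (toℕ k)) ext λ arc →
           isCycle? arc ×-dec all? λ i → ¬? (arc i ∈? F))
    where
    Avoiding : ℕ → Set
    Avoiding k = Σ (Fin (suc k) → Fin m) λ arc →
                 IsCycle D arc × (∀ i → arc i ∉ F)

    ext : ∀ {k} {f g : Fin (suc k) → Fin m} → (∀ i → f i ≡ g i) →
          IsCycle D f × (∀ i → f i ∉ F) → IsCycle D g × (∀ i → g i ∉ F)
    ext f≗g ((inj , closed) , avoid) =
      ( (λ {i} {j} eq → inj (trans (cong tail (f≗g i))
                          (trans eq (cong tail (sym (f≗g j))))))
      , (λ i → trans (cong head (sym (f≗g i)))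
                 (trans (closed i) (cong tail (f≗g (next i))))))
      , λ i → subst (_∉ F) (f≗g i) (avoid i)

  full-FAS : IsFeedbackArcSet D full
  full-FAS (k , arc , _ , avoid) = avoid zero ∈⊤

  abstract
    minimumFAS : ∃ (IsMinimumFAS D)
    minimumFAS = descend m full full-FAS (∣p∣≤n full)
      where
      descend : ∀ k F → IsFeedbackArcSet D F → ∣ F ∣ ℕ.≤ k → ∃ (IsMinimumFAS D)
      descend k F F-fas ∣F∣≤k
        with anySubset? (λ F′ → ¬? (cycleAvoiding? F′) ×-dec ∣ F′ ∣ ℕ.<? ∣ F ∣)
      ... | no  none = F , F-fas , λ F′ F′-fas →
                       ℕ.≮⇒≥ λ F′<F → none (F′ , F′-fas , F′<F)
      descend zero    F F-fas ∣F∣≤0 | yes (F′ , F′-fas , F′<F) =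
        contradiction (ℕ.<-≤-trans F′<F ∣F∣≤0) λ ()
      descend (suc k) F F-fas ∣F∣≤k | yes (F′ , F′-fas , F′<F) =
        descend k F′ F′-fas (ℕ.≤-pred (ℕ.<-≤-trans F′<F ∣F∣≤k))

  fas : ℕ
  fas = ∣ proj₁ minimumFAS ∣

  fas≤ : ∀ F → IsFeedbackArcSet D F → fas ℕ.≤ ∣ F ∣
  fas≤ = proj₂ (proj₂ minimumFAS)

FasBound : (OrientedMultigraph → Set) → ℝ 0ℓ → Set
FasBound 𝒞 c = ∀ D → 𝒞 D → fromℕ (fas D) ≤ c · OrientedMultigraph.n D

-- The infima exist: fas D ≤ m ≤ k n when Δ D ≤ k, and a single pair of
-- vertices joined by k parallel arcs shows that negative c do not qualify.

degree≤Δ : ∀ D v → degree D v ℕ.≤ Δ D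
degree≤Δ D v = All.lookup (xs≤max 0 (map (degree D) (allFin _)))
                 (∈-map⁺ (degree D) (∈-allFin v))

Degree⇒Δ≤ : ∀ {k} D → Degree k D → Δ≤ k D
Degree⇒Δ≤ D deg =
  max≤v⁺ z≤n (All.map⁺ (All.tabulate {xs = allFin _} λ {v} _ → ℕ.≤-reflexive (deg v)))

private
  count : ∀ {A : Set} {n} → (A → Fin n) → List A → Fin n → ℕ
  count f xs v = length (filter (λ x → f x Fin.≟ v) xs)

  others : ∀ {A : Set} {n} → (A → Fin n) → List A → Fin n → List A
  others f xs v = filter (λ x → ¬? (f x Fin.≟ v)) xs

  length-split : ∀ {A : Set} {n} (f : A → Fin n) xs v →
                 length xs ≡ count f xs v ℕ.+ length (others f xs v)
  length-split f []       v = refl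
  length-split f (x ∷ xs) v with f x Fin.≟ v
  ... | yes _ = cong suc (length-split f xs v)
  ... | no  _ = trans (cong suc (length-split f xs v))
                  (sym (ℕ.+-suc (count f xs v) (length (others f xs v))))

  count-others : ∀ {A : Set} {n} (f : A → Fin n) xs v w →
                 count f (others f xs v) w ℕ.≤ count f xs w
  count-others f []       v w = z≤n
  count-others f (x ∷ xs) v w with f x Fin.≟ v
  count-others f (x ∷ xs) v w | yes _ with f x Fin.≟ w
  ... | yes _ = ℕ.m≤n⇒m≤1+n (count-others f xs v w)
  ... | no  _ = count-others f xs v w
  count-others f (x ∷ xs) v w | no _ with f x Fin.≟ w
  ... | yes _ = s≤s (count-others f xs v w)
  ... | no  _ = count-others f xs v w

  all-others : ∀ {A : Set} {n} (f : A → Fin n) {v vs} xs →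
               All (λ x → f x ∈ˡ v ∷ vs) xs →
               All (λ x → f x ∈ˡ vs) (others f xs v)
  all-others f [] [] = []
  all-others f {v} (x ∷ xs) (px ∷ pxs) with f x Fin.≟ v
  ... | yes _    = all-others f xs pxs
  ... | no  fx≢v with px
  ...   | here fx≡v  = contradiction fx≡v fx≢v
  ...   | there fx∈v = fx∈v ∷ all-others f xs pxs

  length≤ : ∀ {A : Set} {n} (f : A → Fin n) k vs xs →
            All (λ x → f x ∈ˡ vs) xs → (∀ v → count f xs v ℕ.≤ k) →
            length xs ℕ.≤ length vs ℕ.* k
  length≤ f k [] [] _ _ = z≤n
  length≤ f k [] (x ∷ xs) (() ∷ _) _
  length≤ f k (v ∷ vs) xs ∈vs cnt =
    subst (ℕ._≤ _) (sym (length-split f xs v))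
      (ℕ.+-mono-≤ (cnt v)
        (length≤ f k vs (others f xs v) (all-others f xs ∈vs)
          λ w → ℕ.≤-trans (count-others f xs v w) (cnt w)))

  length-allFin : ∀ n → length (allFin n) ≡ n
  length-allFin n = length-tabulate {n = n} id

m≤n*Δ : ∀ D → let open OrientedMultigraph D in m ℕ.≤ n ℕ.* Δ D
m≤n*Δ D = subst₂≤ (length-allFin m) (length-allFin n)
  (length≤ tail (Δ D) (allFin n) (allFin m) (All.tabulate λ {e} _ → ∈-allFin (tail e))
    λ v → ℕ.≤-trans (ℕ.m≤m+n _ _) (degree≤Δ D v))
  where
  open OrientedMultigraph D
  subst₂≤ : ∀ {i i′ j j′} → i ≡ i′ → j ≡ j′ → i ℕ.≤ j ℕ.* Δ D → i′ ℕ.≤ j′ ℕ.* Δ D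
  subst₂≤ refl refl = id

private
  toℚᵘ-toℚ : ∀ i → ℚ.toℚᵘ (toℚ i) ℚᵘ.≃ ℚᵘ.mkℚᵘ (+ i) 0
  toℚᵘ-toℚ i = ℚ.toℚᵘ-fromℚᵘ (ℚᵘ.mkℚᵘ (+ i) 0)

  toℚ-mono : ∀ {i j} → i ℕ.≤ j → toℚ i ℚ.≤ toℚ j
  toℚ-mono {i} {j} i≤j = ℚ.toℚᵘ-cancel-≤
    (ℚᵘ.≤-respˡ-≃ (ℚᵘ.≃-sym (toℚᵘ-toℚ i))
      (ℚᵘ.≤-respʳ-≃ (ℚᵘ.≃-sym (toℚᵘ-toℚ j))
        (ℚᵘ.*≤* (ℤ.*-monoʳ-≤-nonNeg (+ 1) (ℤ.+≤+ i≤j)))))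

  toℚ-* : ∀ i j → toℚ (i ℕ.* j) ≡ toℚ i ℚ.* toℚ j
  toℚ-* i j = ℚ.toℚᵘ-injective
    (ℚᵘ.≃-trans (toℚᵘ-toℚ (i ℕ.* j))
      (ℚᵘ.≃-trans (ℚᵘ.*≡* (cong (ℤ._* + 1) (ℤ.pos-* i j)))
        (ℚᵘ.≃-sym (ℚᵘ.≃-trans (ℚ.toℚᵘ-homo-* (toℚ i) (toℚ j))
          (ℚᵘ.*-cong (toℚᵘ-toℚ i) (toℚᵘ-toℚ j))))))

fas≤k·n : ∀ k → FasBound (Δ≤ k) (fromℕ k)
fas≤k·n k D Δ≤k (r , k<r , rn<q) = ℚ.≤-<-trans
  (ℚ.≤-trans (toℚ-mono fas≤kn)
    (ℚ.≤-trans (ℚ.≤-reflexive (toℚ-* k n)) (*toℚ-mono-≤ n (ℚ.<⇒≤ k<r))))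
  rn<q
  where
  open OrientedMultigraph D
  fas≤kn : fas D ℕ.≤ k ℕ.* n
  fas≤kn = begin
    fas D      ≤⟨ fas≤ D full (full-FAS D) ⟩
    ∣ full {m} ∣ ≡⟨ ∣⊤∣≡n m ⟩
    m          ≤⟨ m≤n*Δ D ⟩
    n ℕ.* Δ D  ≤⟨ ℕ.*-monoʳ-≤ n Δ≤k ⟩
    n ℕ.* k    ≡⟨ ℕ.*-comm n k ⟩
    k ℕ.* n    ∎
    where open ℕ.≤-Reasoning

parallel : ℕ → OrientedMultigraph
parallel k = record
  { n = 2
  ; m = k
  ; tail = λ _ → zero
  ; head = λ _ → suc zero
  ; loopless = λ _ ()
  ; no-2-cycle = λ _ _ ()
  }

parallel-Degree : ∀ k → Degree k (parallel k)
parallel-Degree k zero = trans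
  (cong₂ ℕ._+_ (cong length (filter-all (λ _ → zero {1} Fin.≟ zero) {allFin k} (All.tabulate λ _ → refl)))
               (cong length (filter-none (λ _ → suc zero Fin.≟ zero) {allFin k} (All.tabulate λ _ ()))))
  (trans (ℕ.+-identityʳ _) (length-allFin k))
parallel-Degree k (suc zero) = trans
  (cong₂ ℕ._+_ (cong length (filter-none (λ _ → zero {1} Fin.≟ suc zero) {allFin k} (All.tabulate λ _ ())))
               (cong length (filter-all (λ _ → suc (zero {0}) Fin.≟ suc zero) {allFin k} (All.tabulate λ _ → refl))))
  (length-allFin k)

FasBound⇒0≤ : ∀ {𝒞} D → 𝒞 D → ℕ.NonZero (OrientedMultigraph.n D) →
              ∀ c → FasBound 𝒞 c → fromℚ 0ℚ ≤ c
FasBound⇒0≤ D D∈𝒞 n≢0 c bound {q} c<q =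
  let p , p<q , c<p = rounded c c<q
      pn<qn = ℚ.*-monoˡ-<-pos (toℚ n) {{ℚ.normalize-pos n 1 {{_}} {{n≢0}}}} p<q
      fas<qn = bound D D∈𝒞 (p , c<p , pn<qn)
      0<qn = ℚ.≤-<-trans (toℚ-mono {0} {fas D} z≤n) fas<qn
  in ℚ.*-cancelʳ-<-nonNeg (toℚ n) {{toℚ-nonNeg n}}
       (subst (ℚ._< q ℚ.* toℚ n) (sym (ℚ.*-zeroˡ (toℚ n))) 0<qn)
  where open OrientedMultigraph D

c″≤ c″ : ℕ → ℝ (lsuc 0ℓ)

c″≤ k = inf (FasBound (Δ≤ k))
  (fromℕ k , fas≤k·n k)
  (0ℚ , FasBound⇒0≤ (parallel k) (Degree⇒Δ≤ (parallel k) (parallel-Degree k)) _)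

c″ k = inf (FasBound (Degree k))
  (fromℕ k , λ D deg → fas≤k·n k D (Degree⇒Δ≤ D deg))
  (0ℚ , FasBound⇒0≤ (parallel k) (parallel-Degree k) _)

{-# OPTIONS --safe #-}

-- The disjoint union of two copies of D, with k ∸ degree v parallel arcs from
-- the first copy of every vertex v to the second, is degree-k, and a feedback
-- arc set of it contains one of each copy.  So a bound c · n for degree-k
-- graphs is one for all graphs with Δ ≤ k.  For the lower bound we give a
-- graph with 7 vertices, 16 arcs and Δ = 5 that has nine triangles, such that
-- every arc lies on at most two of them; hence fas ≥ ⌈9 / 2⌉ = 5.

module Submission where

open import Defs
open import Data.Bool.Base using (true; false)
open import Data.Fin.Base using (Fin; zero; suc; _↑ˡ_; _↑ʳ_; splitAt; combine)
open import Data.Fin using (#_)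
open import Data.Fin.Properties as Fin using (any?; all?; injective⇒≤)
open import Data.Fin.Subset using (Subset; _∈_; ∣_∣)
open import Data.Fin.Subset.Properties using (_∈?_)
open import Data.Integer.Base as ℤ using (+_)
import Data.Integer.Properties as ℤ
open import Data.List.Base as List using (allFin; filter; length)
open import Data.List.Properties as List using (filter-++; filter-≐; filter-all; filter-none; tabulate-cong)
import Data.List.Relation.Unary.All as All
open import Data.Nat.Base as ℕ using (ℕ; zero; suc; _+_; _∸_)
import Data.Nat.Properties as ℕ
open import Data.Product.Base using (∃; _×_; _,_; proj₁; proj₂)
open import Data.Rational.Base as ℚ using (_/_)
import Data.Rational.Properties as ℚ
import Data.Rational.Unnormalised.Base as ℚᵘ
import Data.Rational.Unnormalised.Properties as ℚᵘ
open import Data.Sum.Base using (inj₁; inj₂)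
open import Data.Sum.Properties using ([,]-map)
open import Data.Vec.Base as Vec using ([]; _∷_; here; there; lookup)
open import Data.Vec.Functional using (_++_; foldr)
open import Data.Vec.Properties using (lookup-++ˡ; lookup-++ʳ; []=⇒lookup; lookup⇒[]=)
import Data.Vec.Functional.Properties as Functional
open import Algebra.Properties.CommutativeSemigroup ℕ.+-commutativeSemigroup using (xy∙z≈xz∙y)
open import Function.Base using (_∘_; id)
open import Function.Definitions using (Injective)
open import Relation.Binary.PropositionalEquality
open import Relation.Nullary using (¬_; ¬?; yes; no; contradiction)
open import Relation.Nullary.Decidable using (from-yes; _→-dec_; _×-dec_)
open import Relation.Unary using (Decidable)

private variable
  A : Set
  k l m n : ℕ

-- Natural numbers among the rationals.

toℚᵘ-toℚ : ∀ i → ℚ.toℚᵘ (toℚ i) ℚᵘ.≃ ℚᵘ.mkℚᵘ (+ i) 0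
toℚᵘ-toℚ i = ℚ.toℚᵘ-fromℚᵘ (ℚᵘ.mkℚᵘ (+ i) 0)

toℚ-mono-≤ : ∀ {i j} → i ℕ.≤ j → toℚ i ℚ.≤ toℚ j
toℚ-mono-≤ {i} {j} i≤j = ℚ.toℚᵘ-cancel-≤
  (ℚᵘ.≤-respˡ-≃ (ℚᵘ.≃-sym (toℚᵘ-toℚ i))
    (ℚᵘ.≤-respʳ-≃ (ℚᵘ.≃-sym (toℚᵘ-toℚ j))
      (ℚᵘ.*≤* (ℤ.*-monoʳ-≤-nonNeg (+ 1) (ℤ.+≤+ i≤j)))))

-- Normalisation keeps `toℚ` from evaluating at variables, so both sides are compared as
-- unnormalised fractions, whose denominators are literally 1.
toℚ-homo-+ : ∀ i j → toℚ (i + j) ≡ toℚ i ℚ.+ toℚ j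
toℚ-homo-+ i j = ℚ.toℚᵘ-injective (begin
  ℚ.toℚᵘ (toℚ (i + j))                       ≈⟨ toℚᵘ-toℚ (i + j) ⟩
  ℚᵘ.mkℚᵘ (+ (i + j)) 0                      ≈⟨ ℚᵘ.*≡* (cong (ℤ._* + 1) +-*1) ⟩
  ℚᵘ.mkℚᵘ (+ i) 0 ℚᵘ.+ ℚᵘ.mkℚᵘ (+ j) 0       ≈⟨ ℚᵘ.+-cong (toℚᵘ-toℚ i) (toℚᵘ-toℚ j) ⟨
  ℚ.toℚᵘ (toℚ i) ℚᵘ.+ ℚ.toℚᵘ (toℚ j)         ≈⟨ ℚ.toℚᵘ-homo-+ (toℚ i) (toℚ j) ⟨
  ℚ.toℚᵘ (toℚ i ℚ.+ toℚ j)                   ∎)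
  where
  open ℚᵘ.≃-Reasoning
  +-*1 : + (i + j) ≡ + i ℤ.* + 1 ℤ.+ + j ℤ.* + 1
  +-*1 = sym (cong₂ ℤ._+_ (ℤ.*-identityʳ (+ i)) (ℤ.*-identityʳ (+ j)))

-- If `q ≤ p`, adding this inequality to itself contradicts the hypothesis. It serves to halve the
-- bound obtained from `doubled`.
+-self-cancel-< : ∀ {p q} → p ℚ.+ p ℚ.< q ℚ.+ q → p ℚ.< q
+-self-cancel-< {p} {q} 2p<2q with p ℚ.<? q
... | yes p<q = p<q
... | no  p≮q = contradiction
  (ℚ.<-≤-trans 2p<2q (ℚ.+-mono-≤ (ℚ.≮⇒≥ p≮q) (ℚ.≮⇒≥ p≮q))) (ℚ.<-irrefl refl)

-- Subsets of finite sets.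

∣++∣ : (p : Subset m) (q : Subset n) → ∣ p Vec.++ q ∣ ≡ ∣ p ∣ + ∣ q ∣
∣++∣ []          q = refl
∣++∣ (true  ∷ p) q = cong suc (∣++∣ p q)
∣++∣ (false ∷ p) q = ∣++∣ p q

∈-++⁻ˡ : (p : Subset m) {q : Subset n} {i : Fin m} → i ↑ˡ n ∈ p Vec.++ q → i ∈ p
∈-++⁻ˡ p {q} {i} i∈ =
  lookup⇒[]= i p (trans (sym (lookup-++ˡ p q i)) ([]=⇒lookup i∈))

∈-++⁻ʳ : (p : Subset m) {q : Subset n} {i : Fin n} → m ↑ʳ i ∈ p Vec.++ q → i ∈ q
∈-++⁻ʳ p {q} {i} i∈ =
  lookup⇒[]= i q (trans (sym (lookup-++ʳ p q i)) ([]=⇒lookup i∈))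

-- The number of elements of `p` before `i`. It turns the arcs of a feedback arc set into an initial
-- segment, ready for the pigeonhole principle.
rank : {p : Subset n} {i : Fin n} → i ∈ p → Fin ∣ p ∣
rank {p = true  ∷ _} here        = zero
rank {p = true  ∷ _} (there i∈p) = suc (rank i∈p)
rank {p = false ∷ _} (there i∈p) = rank i∈p

rank-injective : {p : Subset n} {i j : Fin n} (i∈p : i ∈ p) (j∈p : j ∈ p) →
                 rank i∈p ≡ rank j∈p → i ≡ j
rank-injective {p = true  ∷ _} here        here        _  = refl
rank-injective {p = true  ∷ _} (there i∈p) (there j∈p) eq =
  cong suc (rank-injective i∈p j∈p (Fin.suc-injective eq))
rank-injective {p = false ∷ _} (there i∈p) (there j∈p) eq =
  cong suc (rank-injective i∈p j∈p eq)

-- Sizes of fibres.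

count : (Fin m → Fin n) → Fin n → ℕ
count f v = length (filter (λ e → f e Fin.≟ v) (allFin _))

-- Degrees filter arc indices, and `allFin (l + m)` is not literally a concatenation. Testing values
-- instead of indices gives a tabulated list that splits by `tabulate-++`.
length-filter-tabulate : {P : A → Set} (P? : Decidable P) {B : Set} (f : B → A) (g : Fin m → B) →
  length (filter (P? ∘ f) (List.tabulate g)) ≡ length (filter P? (List.tabulate (f ∘ g)))
length-filter-tabulate {m = zero}  P? f g = refl
length-filter-tabulate {m = suc m} P? f g with P? (f (g zero))
... | yes _ = cong suc (length-filter-tabulate P? f (g ∘ suc))
... | no  _ = length-filter-tabulate P? f (g ∘ suc)

tabulate-++ : (f : Fin m → A) (g : Fin n → A) →
              List.tabulate (f ++ g) ≡ List.tabulate f List.++ List.tabulate g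
tabulate-++ {m = zero}  f g = refl
tabulate-++ {m = suc m} f g = cong (f zero List.∷_) (trans
  -- `splitAt` at a successor maps `suc` over the left summand of the smaller split; this `suc` is
  -- absorbed into `f`.
  (tabulate-cong λ i → [,]-map (splitAt m i))
  (tabulate-++ (f ∘ suc) g))

count-++ : (f : Fin l → Fin n) (g : Fin m → Fin n) (v : Fin n) →
           count (f ++ g) v ≡ count f v + count g v
count-++ f g v = begin
  count (f ++ g) v                                             ≡⟨ tab (f ++ g) ⟩
  occ (List.tabulate (f ++ g))                                 ≡⟨ cong occ (tabulate-++ f g) ⟩
  occ (List.tabulate f List.++ List.tabulate g)                ≡⟨ cong length (filter-++ (Fin._≟ v) (List.tabulate f) _) ⟩
  length (filter (Fin._≟ v) (List.tabulate f) List.++ filter (Fin._≟ v) (List.tabulate g))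
                                                               ≡⟨ List.length-++ (filter (Fin._≟ v) (List.tabulate f)) ⟩
  occ (List.tabulate f) + occ (List.tabulate g)                ≡⟨ cong₂ _+_ (tab f) (tab g) ⟨
  count f v + count g v                                        ∎
  where
  open ≡-Reasoning
  occ : List.List (Fin _) → ℕ
  occ = length ∘ filter (Fin._≟ v)
  tab : ∀ {m} (f : Fin m → Fin _) → count f v ≡ occ (List.tabulate f)
  tab f = length-filter-tabulate (Fin._≟ v) f id

count-injective : {ψ : Fin n → Fin l} → Injective _≡_ _≡_ ψ →
                  (f : Fin m → Fin n) (v : Fin n) → count (ψ ∘ f) (ψ v) ≡ count f v
count-injective {ψ = ψ} ψ-inj f v =
  cong length (filter-≐ (λ e → ψ (f e) Fin.≟ ψ v) (λ e → f e Fin.≟ v) (ψ-inj , cong ψ) (allFin _))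

count-none : (f : Fin m → Fin n) (v : Fin n) → (∀ e → f e ≢ v) → count f v ≡ 0
count-none f v f≢v =
  cong length (filter-none (λ e → f e Fin.≟ v) {allFin _} (All.tabulate λ {e} _ → f≢v e))

count-const : (m : ℕ) (v : Fin n) → count {m} (λ _ → v) v ≡ m
count-const m v = trans
  (cong length (filter-all (λ _ → v Fin.≟ v) {allFin m} (All.tabulate λ _ → refl)))
  (List.length-tabulate {n = m} id)

sum : (Fin n → ℕ) → ℕ
sum = foldr _+_ 0

-- Consecutive blocks, with `d v` indices for `v`. For the deficiency as `d` it enumerates the
-- connecting arcs by the vertex whose degree they fill up.
owner : (d : Fin n → ℕ) → Fin (sum d) → Fin n
owner {n = suc n} d = (λ (_ : Fin (d zero)) → zero) ++ (suc ∘ owner (d ∘ suc))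

count-owner : (d : Fin n → ℕ) (v : Fin n) → count (owner d) v ≡ d v
count-owner d zero = trans (count-++ {d zero} (λ _ → zero) (suc ∘ owner (d ∘ suc)) zero) (trans
  (cong₂ _+_ (count-const (d zero) zero) (count-none (suc ∘ owner (d ∘ suc)) zero λ _ ()))
  (ℕ.+-identityʳ (d zero)))
count-owner d (suc v) = trans (count-++ {d zero} (λ _ → zero) (suc ∘ owner (d ∘ suc)) (suc v)) (
  cong₂ _+_ (count-none {d zero} (λ _ → zero) (suc v) λ _ ())
    (trans (count-injective Fin.suc-injective (owner (d ∘ suc)) v) (count-owner (d ∘ suc) v)))

↑ˡ≢↑ʳ : {i : Fin m} {j : Fin n} → i ↑ˡ n ≢ m ↑ʳ j
↑ˡ≢↑ʳ {m} {n} {i} {j} eq with () ← trans (sym (Fin.splitAt-↑ˡ m i n))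
                                   (trans (cong (splitAt m) eq) (Fin.splitAt-↑ʳ m n j))

-- Embeddings of digraphs.

record Embedding (D E : OrientedMultigraph) : Set where
  private
    module D = OrientedMultigraph D
    module E = OrientedMultigraph E
  field
    vertex   : Fin D.n → Fin E.n
    arc      : Fin D.m → Fin E.m
    vertex-injective : Injective _≡_ _≡_ vertex
    tail-arc : ∀ e → E.tail (arc e) ≡ vertex (D.tail e)
    head-arc : ∀ e → E.head (arc e) ≡ vertex (D.head e)

  -- Injectivity on vertices keeps the tails along the image distinct.
  cycle-image : {c : Fin (suc k) → Fin D.m} → IsCycle D c → IsCycle E (arc ∘ c)
  cycle-image {c = c} (inj , closed) =
      (λ {i} {j} eq → inj (vertex-injective
        (trans (sym (tail-arc (c i))) (trans eq (tail-arc (c j))))))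
    , (λ i → trans (head-arc (c i))
               (trans (cong vertex (closed i)) (sym (tail-arc _))))

  -- The image of a cycle avoiding `F` would avoid `G`.
  restrict-FAS : ∀ {F G} → IsFeedbackArcSet E G → (∀ {e} → arc e ∈ G → e ∈ F) →
                 IsFeedbackArcSet D F
  restrict-FAS G-fas G⊆F (k , c , cyc , avoid) =
    G-fas (k , arc ∘ c , cycle-image cyc , λ i → avoid i ∘ G⊆F)

-- The doubled digraph.

module _ (k : ℕ) (D : OrientedMultigraph) where
  open OrientedMultigraph D renaming (n to ∣V∣; m to ∣A∣)

  private
    -- Under `Δ≤ k D` the truncated subtraction is exact, which `doubled-Degree` relies on.
    deficiency : Fin ∣V∣ → ℕ
    deficiency v = k ∸ degree D v

    left right : Fin ∣V∣ → Fin (∣V∣ + ∣V∣)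
    left  = _↑ˡ ∣V∣
    right = ∣V∣ ↑ʳ_

    left-injective : Injective _≡_ _≡_ left
    left-injective = Fin.↑ˡ-injective ∣V∣ _ _

    right-injective : Injective _≡_ _≡_ right
    right-injective = Fin.↑ʳ-injective ∣V∣ _ _

  doubled : OrientedMultigraph
  doubled = record
    { n          = ∣V∣ + ∣V∣
    ; m          = ∣A∣ + (∣A∣ + sum deficiency)
    ; tail       = tail′
    ; head       = head′
    ; loopless   = loopless′
    ; no-2-cycle = no-2-cycle′
    }
    where
    tail′ head′ : Fin (∣A∣ + (∣A∣ + sum deficiency)) → Fin (∣V∣ + ∣V∣)
    tail′ = left ∘ tail ++ (right ∘ tail ++ left  ∘ owner deficiency)
    head′ = left ∘ head ++ (right ∘ head ++ right ∘ owner deficiency)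

    loopless′ : ∀ e → tail′ e ≢ head′ e
    loopless′ e with splitAt ∣A∣ e
    ... | inj₁ i = loopless i ∘ left-injective
    ... | inj₂ e′ with splitAt ∣A∣ e′
    ...   | inj₁ i = loopless i ∘ right-injective
    ...   | inj₂ _ = ↑ˡ≢↑ʳ

    -- Opposite arcs in one copy come from a 2-cycle of `D`. In all other cases one of the equations
    -- identifies a left with a right vertex, because connecting arcs only run from left to right.
    no-2-cycle′ : ∀ e f → ¬ (head′ e ≡ tail′ f × head′ f ≡ tail′ e)
    no-2-cycle′ e f with splitAt ∣A∣ e | splitAt ∣A∣ f
    ... | inj₁ i | inj₁ j = λ (p , q) →
      no-2-cycle i j (left-injective p , left-injective q)
    ... | inj₁ i | inj₂ f′ with splitAt ∣A∣ f′
    ...   | inj₁ _ = ↑ˡ≢↑ʳ ∘ proj₁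
    ...   | inj₂ _ = ↑ˡ≢↑ʳ ∘ sym ∘ proj₂
    no-2-cycle′ e f | inj₂ e′ | inj₁ j with splitAt ∣A∣ e′
    ...   | inj₁ _ = ↑ˡ≢↑ʳ ∘ sym ∘ proj₁
    ...   | inj₂ _ = ↑ˡ≢↑ʳ ∘ sym ∘ proj₁
    no-2-cycle′ e f | inj₂ e′ | inj₂ f′ with splitAt ∣A∣ e′ | splitAt ∣A∣ f′
    ...   | inj₁ i | inj₁ j = λ (p , q) →
      no-2-cycle i j (right-injective p , right-injective q)
    ...   | inj₁ _ | inj₂ _ = ↑ˡ≢↑ʳ ∘ sym ∘ proj₁
    ...   | inj₂ _ | inj₁ _ = ↑ˡ≢↑ʳ ∘ sym ∘ proj₂
    ...   | inj₂ _ | inj₂ _ = ↑ˡ≢↑ʳ ∘ sym ∘ proj₁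

  -- Degrees in the doubled digraph.

  private
    count-left-right≡0 : (f : Fin m → Fin ∣V∣) (v : Fin ∣V∣) → count (left ∘ f) (right v) ≡ 0
    count-left-right≡0 f v = count-none (left ∘ f) (right v) λ _ → ↑ˡ≢↑ʳ

    count-right-left≡0 : (f : Fin m → Fin ∣V∣) (v : Fin ∣V∣) → count (right ∘ f) (left v) ≡ 0
    count-right-left≡0 f v = count-none (right ∘ f) (left v) λ _ → ↑ˡ≢↑ʳ ∘ sym

    module _ (f : Fin m → Fin ∣V∣) (g : Fin l → Fin ∣V∣) (v : Fin ∣V∣) where
      -- Here `f` is meant to be `tail` or `head`, and `h` the corresponding end of the connecting
      -- arcs: `left ∘ g` for tails and `right ∘ g` for heads, where `g` is `owner deficiency`.
      count-++₃ : ∀ (h : Fin l → Fin (∣V∣ + ∣V∣)) w →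
                  count (left ∘ f ++ (right ∘ f ++ h)) w ≡
                  count (left ∘ f) w + (count (right ∘ f) w + count h w)
      count-++₃ h w = trans (count-++ (left ∘ f) (right ∘ f ++ h) w)
                        (cong (count (left ∘ f) w ℕ.+_) (count-++ (right ∘ f) h w))

      count-++-left : ∀ (h : Fin l → Fin (∣V∣ + ∣V∣)) →
                      count (left ∘ f ++ (right ∘ f ++ h)) (left v) ≡ count f v + count h (left v)
      count-++-left h = trans (count-++₃ h (left v)) (cong₂ _+_
        (count-injective left-injective f v)
        (cong (_+ count h (left v)) (count-right-left≡0 f v)))

      count-++-right : ∀ (h : Fin l → Fin (∣V∣ + ∣V∣)) →
                       count (left ∘ f ++ (right ∘ f ++ h)) (right v) ≡ count f v + count h (right v)
      count-++-right h = trans (count-++₃ h (right v)) (cong₂ _+_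
        (count-left-right≡0 f v)
        (cong (_+ count h (right v)) (count-injective right-injective f v)))

      count-left-left : count (left ∘ f ++ (right ∘ f ++ left ∘ g)) (left v) ≡ count f v + count g v
      count-left-left = trans (count-++-left (left ∘ g))
        (cong (count f v ℕ.+_) (count-injective left-injective g v))

      count-right-left : count (left ∘ f ++ (right ∘ f ++ right ∘ g)) (left v) ≡ count f v
      count-right-left = trans (count-++-left (right ∘ g))
        (trans (cong (count f v ℕ.+_) (count-right-left≡0 g v)) (ℕ.+-identityʳ _))

      count-left-right : count (left ∘ f ++ (right ∘ f ++ left ∘ g)) (right v) ≡ count f v
      count-left-right = trans (count-++-right (left ∘ g))
        (trans (cong (count f v ℕ.+_) (count-left-right≡0 g v)) (ℕ.+-identityʳ _))

      count-right-right : count (left ∘ f ++ (right ∘ f ++ right ∘ g)) (right v) ≡ count f v + count g v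
      count-right-right = trans (count-++-right (right ∘ g))
        (cong (count f v ℕ.+_) (count-injective right-injective g v))

  -- The connecting arcs add the deficiency of `v` to the out-degree of its left copy and to the
  -- in-degree of its right copy.
  doubled-Degree : Δ≤ k D → Degree k doubled
  doubled-Degree Δ≤k w with splitAt ∣V∣ w in eq
  ... | inj₁ v = subst (λ w → degree doubled w ≡ k) (Fin.splitAt⁻¹-↑ˡ eq) (begin
    degree doubled (left v)                          ≡⟨ cong₂ _+_ (count-left-left tail (owner deficiency) v)
                                                                  (count-right-left head (owner deficiency) v) ⟩
    out + count (owner deficiency) v + indegree D v  ≡⟨ cong (λ d → out + d + indegree D v) (count-owner deficiency v) ⟩
    out + deficiency v + indegree D v                ≡⟨ xy∙z≈xz∙y out _ _ ⟩
    degree D v + deficiency v                        ≡⟨ ℕ.m+[n∸m]≡n (ℕ.≤-trans (degree≤Δ D v) Δ≤k) ⟩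
    k                                                ∎)
    where
    open ≡-Reasoning
    out = outdegree D v
  ... | inj₂ v = subst (λ w → degree doubled w ≡ k) (Fin.splitAt⁻¹-↑ʳ eq) (begin
    degree doubled (right v)                         ≡⟨ cong₂ _+_ (count-left-right tail (owner deficiency) v)
                                                                  (count-right-right head (owner deficiency) v) ⟩
    out + (indegree D v + count (owner deficiency) v) ≡⟨ cong (λ d → out + (indegree D v + d)) (count-owner deficiency v) ⟩
    out + (indegree D v + deficiency v)              ≡⟨ ℕ.+-assoc out _ _ ⟨
    degree D v + deficiency v                        ≡⟨ ℕ.m+[n∸m]≡n (ℕ.≤-trans (degree≤Δ D v) Δ≤k) ⟩
    k                                                ∎)
    where
    open ≡-Reasoning
    out = outdegree D v

  embedˡ embedʳ : Embedding D doubled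
  embedˡ = record
    { vertex = left ; arc = _↑ˡ _ ; vertex-injective = left-injective
    ; tail-arc = λ e → Functional.lookup-++ˡ _ _ e
    ; head-arc = λ e → Functional.lookup-++ˡ _ _ e
    }
  embedʳ = record
    { vertex = right ; arc = λ e → ∣A∣ ↑ʳ (e ↑ˡ _) ; vertex-injective = right-injective
    ; tail-arc = λ e → trans (Functional.lookup-++ʳ (left ∘ tail) _ _) (Functional.lookup-++ˡ (right ∘ tail) _ e)
    ; head-arc = λ e → trans (Functional.lookup-++ʳ (left ∘ head) _ _) (Functional.lookup-++ˡ (right ∘ head) _ e)
    }

  fas-doubled : fas D + fas D ℕ.≤ fas doubled
  fas-doubled with minimumFAS doubled
  -- Arcs are numbered block by block, so cutting the vector `F` yields its traces on the left copy,
  -- the right copy and the connecting arcs.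
  ... | F , F-fas , _ with Vec.splitAt ∣A∣ F
  ... | F₁ , F₂₃ , refl with Vec.splitAt ∣A∣ F₂₃
  ... | F₂ , F₃ , refl = begin
    fas D + fas D
      ≤⟨ ℕ.+-mono-≤ (fas≤ D F₁ (Embedding.restrict-FAS embedˡ F-fas (∈-++⁻ˡ F₁)))
                    (fas≤ D F₂ (Embedding.restrict-FAS embedʳ F-fas (∈-++⁻ˡ F₂ ∘ ∈-++⁻ʳ F₁))) ⟩
    ∣ F₁ ∣ + ∣ F₂ ∣                 ≤⟨ ℕ.+-monoʳ-≤ ∣ F₁ ∣ (ℕ.m≤m+n ∣ F₂ ∣ ∣ F₃ ∣) ⟩
    ∣ F₁ ∣ + (∣ F₂ ∣ + ∣ F₃ ∣)      ≡⟨ cong (∣ F₁ ∣ ℕ.+_) (∣++∣ F₂ F₃) ⟨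
    ∣ F₁ ∣ + ∣ F₂ Vec.++ F₃ ∣       ≡⟨ ∣++∣ F₁ (F₂ Vec.++ F₃) ⟨
    ∣ F₁ Vec.++ F₂ Vec.++ F₃ ∣      ∎
    where open ℕ.≤-Reasoning

-- Lower bounds from families of cycles.

module _ (D : OrientedMultigraph) where
  open OrientedMultigraph D using () renaming (m to ∣A∣)

  -- Being a feedback arc set is a negative statement; a decidable search along the finite cycle
  -- extracts an actual arc from it.
  FAS-hits : ∀ {F} → IsFeedbackArcSet D F → {c : Fin (suc l) → Fin ∣A∣} →
             IsCycle D c → ∃ λ i → c i ∈ F
  FAS-hits {l = l} {F} F-fas {c} cyc with any? (λ i → c i ∈? F)
  ... | yes hit  = hit
  ... | no  miss = contradiction (l , c , cyc , λ i i∈F → miss (i , i∈F)) F-fas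

  -- The slots witness that every arc lies on at most k of the p cycles.
  cycle-packing : ∀ {p} (c : Fin p → Fin (suc l) → Fin ∣A∣) (slot : Fin p → Fin (suc l) → Fin k) →
    (∀ i → IsCycle D (c i)) →
    (∀ i i′ j j′ → c i j ≡ c i′ j′ → slot i j ≡ slot i′ j′ → i ≡ i′) →
    p ℕ.≤ fas D ℕ.* k
  cycle-packing c slot cyc slot-inj = injective⇒≤ {f = place} place-injective
    where
    F = proj₁ (minimumFAS D)
    hit = λ i → FAS-hits (proj₁ (proj₂ (minimumFAS D))) (cyc i)

    -- Each cycle is sent to an arc of `F` on it together with its slot there. Injectivity of this
    -- map bounds the number of cycles by the number of such pairs.
    place : Fin _ → Fin (∣ F ∣ ℕ.* _)
    place i = combine (rank (proj₂ (hit i))) (slot i (proj₁ (hit i)))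

    place-injective : Injective _≡_ _≡_ place
    place-injective {i} {i′} eq =
      let rank≡ , slot≡ = Fin.combine-injective _ _ _ _ eq in
      slot-inj i i′ _ _ (rank-injective (proj₂ (hit i)) (proj₂ (hit i′)) rank≡) slot≡

-- Doubling multiplies the number of vertices by two and `fas` by at least two, so the bound for
-- `doubled k D` at `q + q` halves to the one for `D` at `q`.
FasBound-Degree⇒Δ≤ : ∀ k c → FasBound (Degree k) c → FasBound (Δ≤ k) c
FasBound-Degree⇒Δ≤ k c bound D Δ≤k {q} (r , c<r , rn<q) = +-self-cancel-< (begin-strict
  toℚ (fas D) ℚ.+ toℚ (fas D)  ≡⟨ toℚ-homo-+ (fas D) (fas D) ⟨
  toℚ (fas D + fas D)          ≤⟨ toℚ-mono-≤ (fas-doubled k D) ⟩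
  toℚ (fas (doubled k D))      <⟨ bound (doubled k D) (doubled-Degree k D Δ≤k) (r , c<r , r2n<2q) ⟩
  q ℚ.+ q                      ∎)
  where
  open ℚ.≤-Reasoning
  ∣V∣ = OrientedMultigraph.n D

  -- The same `r` above `c` thus witnesses the bound on twice as many vertices.
  r2n<2q : r ℚ.* toℚ (∣V∣ + ∣V∣) ℚ.< q ℚ.+ q
  r2n<2q = begin-strict
    r ℚ.* toℚ (∣V∣ + ∣V∣)              ≡⟨ cong (r ℚ.*_) (toℚ-homo-+ ∣V∣ ∣V∣) ⟩
    r ℚ.* (toℚ ∣V∣ ℚ.+ toℚ ∣V∣)        ≡⟨ ℚ.*-distribˡ-+ r (toℚ ∣V∣) (toℚ ∣V∣) ⟩
    r ℚ.* toℚ ∣V∣ ℚ.+ r ℚ.* toℚ ∣V∣    <⟨ ℚ.+-mono-< rn<q rn<q ⟩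
    q ℚ.+ q                            ∎

-- A digraph on seven vertices.

D₇ : OrientedMultigraph
D₇ = record
  { n          = 7
  ; m          = 16
  ; tail       = tail
  ; head       = head
  ; loopless   = from-yes (all? λ e → ¬? (tail e Fin.≟ head e))
  ; no-2-cycle = from-yes (all? λ e → all? λ f →
                   ¬? (head e Fin.≟ tail f ×-dec head f Fin.≟ tail e))
  }
  where
  -- Vertices 1, 3 and 6 have degree 4, the other four have degree 5.
  tail head : Fin 16 → Fin 7
  tail = lookup (# 0 ∷ # 0 ∷ # 0 ∷ # 1 ∷ # 1 ∷ # 2 ∷ # 2 ∷ # 3 ∷
                 # 3 ∷ # 4 ∷ # 4 ∷ # 4 ∷ # 5 ∷ # 5 ∷ # 6 ∷ # 6 ∷ [])
  head = lookup (# 1 ∷ # 2 ∷ # 6 ∷ # 3 ∷ # 4 ∷ # 3 ∷ # 6 ∷ # 0 ∷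
                 # 5 ∷ # 0 ∷ # 2 ∷ # 5 ∷ # 1 ∷ # 2 ∷ # 4 ∷ # 5 ∷ [])

5≤fas-D₇ : 5 ℕ.≤ fas D₇
-- The packing gives `9 ≤ fas D₇ * 2`, which is `4 * 2 < fas D₇ * 2` by computation; cancelling in
-- the strict form rounds 9 / 2 up.
5≤fas-D₇ = ℕ.*-cancelʳ-< 2 4 (fas D₇)
  (cycle-packing D₇ triangle slot
    (from-yes (all? λ i → isCycle? D₇ (triangle i)))
    (from-yes (all? λ i → all? λ i′ → all? λ j → all? λ j′ →
      triangle i j Fin.≟ triangle i′ j′ →-dec slot i j Fin.≟ slot i′ j′ →-dec i Fin.≟ i′)))
  where
  -- In vertices: 013, 014, 023, 064, 135, 145, 235, 264, 265. Eleven arcs occur in two rows and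
  -- five in one.
  triangle : Fin 9 → Fin 3 → Fin 16
  triangle = lookup ∘ lookup
    ( (# 0 ∷ # 3  ∷ # 7  ∷ [])
    ∷ (# 0 ∷ # 4  ∷ # 9  ∷ [])
    ∷ (# 1 ∷ # 5  ∷ # 7  ∷ [])
    ∷ (# 2 ∷ # 14 ∷ # 9  ∷ [])
    ∷ (# 3 ∷ # 8  ∷ # 12 ∷ [])
    ∷ (# 4 ∷ # 11 ∷ # 12 ∷ [])
    ∷ (# 5 ∷ # 8  ∷ # 13 ∷ [])
    ∷ (# 6 ∷ # 14 ∷ # 10 ∷ [])
    ∷ (# 6 ∷ # 15 ∷ # 13 ∷ [])
    ∷ [])

  -- Each entry counts the earlier rows of `triangle` that contain the same arc.
  slot : Fin 9 → Fin 3 → Fin 2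
  slot = lookup ∘ lookup
    ( (# 0 ∷ # 0 ∷ # 0 ∷ [])
    ∷ (# 1 ∷ # 0 ∷ # 0 ∷ [])
    ∷ (# 0 ∷ # 0 ∷ # 1 ∷ [])
    ∷ (# 0 ∷ # 0 ∷ # 1 ∷ [])
    ∷ (# 1 ∷ # 0 ∷ # 0 ∷ [])
    ∷ (# 1 ∷ # 0 ∷ # 1 ∷ [])
    ∷ (# 1 ∷ # 1 ∷ # 0 ∷ [])
    ∷ (# 0 ∷ # 1 ∷ # 0 ∷ [])
    ∷ (# 1 ∷ # 0 ∷ # 1 ∷ [])
    ∷ [])

proposition9 : (c″ 5 ≃ c″≤ 5) × (c″≤ 5 ≥ fromℚ (+ 5 / 7))
proposition9 =
    -- `x ≤ y` sends rationals above `y` to rationals above `x`. So the first half restricts a bound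
    -- to the smaller class, and the second extends it by doubling.
    ( (λ (c , bound , c<q) → c , (λ D Δ≤5 → bound D (Degree⇒Δ≤ D Δ≤5)) , c<q)
    , (λ (c , bound , c<q) → c , FasBound-Degree⇒Δ≤ 5 c bound , c<q))
  , λ {q} (c , bound , c<q) →
      -- The cut of `c · 7` demands a strict gap, which a rational `p` above `c` and below `q`
      -- provides.
      let p , p<q , c<p = rounded c c<q
          5<7q = ℚ.≤-<-trans (toℚ-mono-≤ 5≤fas-D₇)
                   (bound D₇ (from-yes (Δ D₇ ℕ.≤? 5))
                     (p , c<p , ℚ.*-monoˡ-<-pos (toℚ 7) p<q))
      -- `5 / 7` times `toℚ 7` evaluates to `toℚ 5`.
      in ℚ.*-cancelʳ-<-nonNeg (toℚ 7) 5<7q
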